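{- Let $\mathbf A=(A;\cdot,\to,\leadsto,1)$ be a pseudo-hoop and let $M\subseteq A$ be any subset. Define $f:M^\perp\times M^{\perp\perp}\to A$ by $f(x,y)=x\wedge y$. Then $f$ is injective and, for all $(x_1,y_1),(x_2,y_2)\in M^\perp\times M^{\perp\perp}$, $$f(x_1,y_1)\cdot f(x_2,y_2)=f(x_1\cdot x_2,\,y_1\cdot y_2),\quad f(x_1,y_1)\to f(x_2,y_2)=f(x_1\to x_2,\,y_1\to y_2),$$ $$f(x_1,y_1)\leadsto f(x_2,y_2)=f(x_1\leadsto x_2,\,y_1\leadsto y_2);$$ i.e. $f$ is an embedding of the direct product pseudo-hoop $M^\perp\times M^{\perp\perp}$ into $\mathbf A$.
   Context: A pseudo-hoop is an algebra $(A;\cdot,\to,\leadsto,1)$ of type $\langle 2,2,2,0\rangle$ such that for all $x,y,z\in A$: $x\cdot 1=x=1\cdot x$; $x\to x=1=x\leadsto x$; $(x\cdot y)\to z=x\to(y\to z)$; $(x\cdot y)\leadsto z=y\leadsto(x\leadsto z)$; and $(x\to y)\cdot x=(y\to x)\cdot y=x\cdot(x\leadsto y)=y\cdot(y\leadsto x)$. Setting $x\le y$ iff $x\to y=1$ (equivalently $x\leadsto y=1$) gives a partial order with greatest element $1$ in which $x\wedge y=(x\to y)\cdot x$ exists for all $x,y$. For $x,y\in A$, "$x\vee y=1$" means that the supremum of $\{x,y\}$ exists and equals $1$. For $M\subseteq A$, $M^\perp=\{x\in A\mid x\vee y=1\text{ for every }y\in M\}$ and $M^{\perp\perp}=(M^\perp)^\perp$.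 The sets $M^\perp$ and $M^{\perp\perp}$ contain $1$ and are closed under $\cdot,\to,\leadsto$, so $M^\perp\times M^{\perp\perp}$ is a pseudo-hoop with componentwise operations. -}

module Defs where

open import Algebra.Core using (Op₂)
open import Algebra.Definitions using (Congruent₂)
open import Data.Product.Base using (Σ; _×_; _,_; proj₁; proj₂; zip)
open import Data.Product.Relation.Binary.Pointwise.NonDependent
  using (Pointwise; ×-isEquivalence)
open import Function.Base using (flip; _on_)
open import Function.Definitions using (Congruent; Injective)
open import Level using (Level; _⊔_; suc)
open import Relation.Binary.Bundles using (Setoid)
open import Relation.Binary.Core using (Rel)
open import Relation.Binary.Lattice.Definitions using (Infimum)
open import Relation.Binary.Structures using (IsEquivalence; IsPartialOrder)
open import Relation.Unary using (Pred; _∈_)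
import Relation.Binary.Construct.On as On
import Relation.Binary.Reasoning.Setoid as SetoidReasoning

-- As in Algebra.Bundles, equality is an equivalence relation that the
-- operations respect; _⇒_ is usually written →.  Associativity of _·_ is
-- not an axiom; it is derived below.

record PseudoHoop (c ℓ : Level) : Set (suc (c ⊔ ℓ)) where
  infix  4 _≈_
  infixr 6 _⇒_ _⇝_
  infixl 7 _·_
  field
    Carrier       : Set c
    _≈_           : Rel Carrier ℓ
    _·_           : Op₂ Carrier
    _⇒_           : Op₂ Carrier
    _⇝_           : Op₂ Carrier
    1#            : Carrier
    isEquivalence : IsEquivalence _≈_
    ·-cong        : Congruent₂ _≈_ _·_
    ⇒-cong        : Congruent₂ _≈_ _⇒_
    ⇝-cong        : Congruent₂ _≈_ _⇝_
    ·-identityʳ   : ∀ x → x · 1# ≈ x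
    ·-identityˡ   : ∀ x → 1# · x ≈ x
    ⇒-self        : ∀ x → x ⇒ x ≈ 1#
    ⇝-self        : ∀ x → x ⇝ x ≈ 1#
    ⇒-curry       : ∀ x y z → (x · y) ⇒ z ≈ x ⇒ (y ⇒ z)
    ⇝-curry       : ∀ x y z → (x · y) ⇝ z ≈ y ⇝ (x ⇝ z)
    -- (x ⇒ y) · x = (y ⇒ x) · y = x · (x ⇝ y) = y · (y ⇝ x)
    ⇒-div         : ∀ x y → (x ⇒ y) · x ≈ (y ⇒ x) · y
    ⇒⇝-div        : ∀ x y → (y ⇒ x) · y ≈ x · (x ⇝ y)
    ⇝-div         : ∀ x y → x · (x ⇝ y) ≈ y · (y ⇝ x)

  open IsEquivalence isEquivalence public
    using (refl; sym; trans; reflexive)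

  setoid : Setoid c ℓ
  setoid = record { isEquivalence = isEquivalence }

  infix 4 _≤_
  _≤_ : Rel Carrier ℓ
  x ≤ y = x ⇒ y ≈ 1#

  -- The infimum of x and y; see ∧-infimum below.
  infixr 7 _∧_
  _∧_ : Op₂ Carrier
  x ∧ y = (x ⇒ y) · x

  IsSupremumOf : Carrier → Carrier → Carrier → Set (c ⊔ ℓ)
  IsSupremumOf x y s = x ≤ s × y ≤ s × (∀ z → x ≤ z → y ≤ z → s ≤ z)

  -- "x ∨ y = 1": the join is partial, so this asserts that the supremum
  -- exists and is 1.
  _∨_≈1 : Carrier → Carrier → Set (c ⊔ ℓ)
  x ∨ y ≈1 = IsSupremumOf x y 1#

  infix 8 _^⊥ _^⊥⊥
  _^⊥ : ∀ {p} → Pred Carrier p → Pred Carrier (c ⊔ ℓ ⊔ p)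
  (M ^⊥) x = ∀ {y} → y ∈ M → x ∨ y ≈1

  _^⊥⊥ : ∀ {p} → Pred Carrier p → Pred Carrier (c ⊔ ℓ ⊔ p)
  M ^⊥⊥ = (M ^⊥) ^⊥

opposite : ∀ {c ℓ} → PseudoHoop c ℓ → PseudoHoop c ℓ
opposite A = record
  { Carrier       = Carrier
  ; _≈_           = _≈_
  ; _·_           = flip _·_
  ; _⇒_           = _⇝_
  ; _⇝_           = _⇒_
  ; 1#            = 1#
  ; isEquivalence = isEquivalence
  ; ·-cong        = flip ·-cong
  ; ⇒-cong        = ⇝-cong
  ; ⇝-cong        = ⇒-cong
  ; ·-identityʳ   = ·-identityˡ
  ; ·-identityˡ   = ·-identityʳ
  ; ⇒-self        = ⇝-self
  ; ⇝-self        = ⇒-self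
  ; ⇒-curry       = λ x y z → ⇝-curry y x z
  ; ⇝-curry       = λ x y z → ⇒-curry y x z
  ; ⇒-div         = ⇝-div
  ; ⇒⇝-div        = λ x y →
      trans (⇝-div y x) (trans (sym (⇒⇝-div x y)) (sym (⇒-div x y)))
  ; ⇝-div         = ⇒-div
  }
  where open PseudoHoop A

module ResidualProperties {c ℓ} (A : PseudoHoop c ℓ) where
  open PseudoHoop A
  open SetoidReasoning setoid

  ≤-refl : ∀ {x} → x ≤ x
  ≤-refl {x} = ⇒-self x

  ≤-antisym : ∀ {x y} → x ≤ y → y ≤ x → x ≈ y
  ≤-antisym {x} {y} x≤y y≤x = begin
    x            ≈⟨ ·-identityˡ x ⟨
    1# · x       ≈⟨ ·-cong x≤y refl ⟨
    (x ⇒ y) · x  ≈⟨ ⇒-div x y ⟩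
    (y ⇒ x) · y  ≈⟨ ·-cong y≤x refl ⟩
    1# · y       ≈⟨ ·-identityˡ y ⟩
    y            ∎

  ·-assoc : ∀ x y z → (x · y) · z ≈ x · (y · z)
  ·-assoc x y z = ≤-antisym
    (trans (shift _) (⇒-self _)) (trans (sym (shift _)) (⇒-self _))
    where
    shift : ∀ w → ((x · y) · z) ⇒ w ≈ (x · (y · z)) ⇒ w
    shift w = begin
      ((x · y) · z) ⇒ w  ≈⟨ ⇒-curry (x · y) z w ⟩
      (x · y) ⇒ (z ⇒ w)  ≈⟨ ⇒-curry x y (z ⇒ w) ⟩
      x ⇒ (y ⇒ (z ⇒ w))  ≈⟨ ⇒-cong refl (⇒-curry y z w) ⟨
      x ⇒ ((y · z) ⇒ w)  ≈⟨ ⇒-curry x (y · z) w ⟨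
      (x · (y · z)) ⇒ w  ∎

  1⇒-div : ∀ x → 1# ⇒ x ≈ (x ⇒ 1#) · x
  1⇒-div x = trans (sym (·-identityʳ (1# ⇒ x))) (⇒-div 1# x)

  x≤1⇒x : ∀ x → x ≤ 1# ⇒ x
  x≤1⇒x x = begin
    x ⇒ (1# ⇒ x)  ≈⟨ ⇒-curry x 1# x ⟨
    (x · 1#) ⇒ x  ≈⟨ ⇒-cong (·-identityʳ x) refl ⟩
    x ⇒ x         ≈⟨ ⇒-self x ⟩
    1#            ∎

  1⇒-identity : ∀ x → 1# ⇒ x ≈ x
  1⇒-identity x = begin
    a            ≈⟨ 1⇒-div x ⟩
    u · x        ≈⟨ ·-cong v·u≈u refl ⟨
    (v · u) · x  ≈⟨ ·-assoc v u x ⟩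
    v · (u · x)  ≈⟨ ·-cong refl (1⇒-div x) ⟨
    v · a        ≈⟨ ·-cong a⇒x≈v refl ⟨
    (a ⇒ x) · a  ≈⟨ ⇒-div a x ⟩
    (x ⇒ a) · x  ≈⟨ ·-cong (x≤1⇒x x) refl ⟩
    1# · x       ≈⟨ ·-identityˡ x ⟩
    x            ∎
    where
    a u v : Carrier
    a = 1# ⇒ x
    u = x ⇒ 1#
    v = u ⇒ 1#
    v·u≈u : v · u ≈ u
    v·u≈u = begin
      v · u          ≈⟨ 1⇒-div u ⟨
      1# ⇒ (x ⇒ 1#)  ≈⟨ ⇒-curry 1# x 1# ⟨
      (1# · x) ⇒ 1#  ≈⟨ ⇒-cong (·-identityˡ x) refl ⟩
      u              ∎
    a⇒x≈v : a ⇒ x ≈ v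
    a⇒x≈v = begin
      a ⇒ x        ≈⟨ ⇒-cong (1⇒-div x) refl ⟩
      (u · x) ⇒ x  ≈⟨ ⇒-curry u x x ⟩
      u ⇒ (x ⇒ x)  ≈⟨ ⇒-cong refl (⇒-self x) ⟩
      v            ∎

  ≤-maximum : ∀ x → x ≤ 1#
  ≤-maximum x = begin
    x ⇒ 1#                ≈⟨ ⇒-cong (trans (sym (1⇒-div x)) (1⇒-identity x)) refl ⟨
    ((x ⇒ 1#) · x) ⇒ 1#   ≈⟨ ⇒-curry (x ⇒ 1#) x 1# ⟩
    (x ⇒ 1#) ⇒ (x ⇒ 1#)   ≈⟨ ⇒-self (x ⇒ 1#) ⟩
    1#                    ∎

  ≤⇒≈∧ : ∀ {x y} → x ≤ y → x ≈ (y ⇒ x) · y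
  ≤⇒≈∧ {x} {y} x≤y = begin
    x            ≈⟨ ·-identityˡ x ⟨
    1# · x       ≈⟨ ·-cong x≤y refl ⟨
    (x ⇒ y) · x  ≈⟨ ⇒-div x y ⟩
    (y ⇒ x) · y  ∎

  ≤-trans : ∀ {x y z} → x ≤ y → y ≤ z → x ≤ z
  ≤-trans {x} {y} {z} x≤y y≤z = begin
    x ⇒ z              ≈⟨ ⇒-cong (≤⇒≈∧ x≤y) refl ⟩
    ((y ⇒ x) · y) ⇒ z  ≈⟨ ⇒-curry (y ⇒ x) y z ⟩
    (y ⇒ x) ⇒ (y ⇒ z)  ≈⟨ ⇒-cong refl y≤z ⟩
    (y ⇒ x) ⇒ 1#       ≈⟨ ≤-maximum (y ⇒ x) ⟩
    1#                 ∎

  ≤-reflexive : ∀ {x y} → x ≈ y → x ≤ y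
  ≤-reflexive x≈y = trans (⇒-cong x≈y refl) ≤-refl

  ≤-isPartialOrder : IsPartialOrder _≈_ _≤_
  ≤-isPartialOrder = record
    { isPreorder = record
      { isEquivalence = isEquivalence
      ; reflexive     = ≤-reflexive
      ; trans         = ≤-trans
      }
    ; antisym = ≤-antisym
    }

  residualˡ : ∀ {x y z} → x · y ≤ z → x ≤ y ⇒ z
  residualˡ {x} {y} {z} p = trans (sym (⇒-curry x y z)) p

  unresidualˡ : ∀ {x y z} → x ≤ y ⇒ z → x · y ≤ z
  unresidualˡ {x} {y} {z} p = trans (⇒-curry x y z) p

  x∧y≤y : ∀ x y → x ∧ y ≤ y
  x∧y≤y x y = unresidualˡ ≤-refl

  x∧y≤x : ∀ x y → x ∧ y ≤ x
  x∧y≤x x y = ≤-trans (≤-reflexive (⇒-div x y)) (x∧y≤y y x)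

  ∧-greatest : ∀ {x y z} → z ≤ x → z ≤ y → z ≤ x ∧ y
  ∧-greatest {x} {y} {z} z≤x z≤y =
    ≤-trans (≤-reflexive (≤⇒≈∧ z≤x))
      (unresidualˡ (≤-trans (residualˡ (≤-trans (x∧y≤y x z) z≤y)) (residualˡ ≤-refl)))

  ∧-infimum : Infimum _≤_ _∧_
  ∧-infimum x y = x∧y≤x x y , x∧y≤y x y , λ _ → ∧-greatest

module Properties {c ℓ} (A : PseudoHoop c ℓ) where
  open PseudoHoop A
  open ResidualProperties A public
  open SetoidReasoning setoid

  private
    module Op = ResidualProperties (opposite A)

  ≤⇒⇝≈1 : ∀ {x y} → x ≤ y → x ⇝ y ≈ 1#
  ≤⇒⇝≈1 {x} {y} x≤y = begin
    x ⇝ y              ≈⟨ ⇝-cong x≈y·[y⇝x] refl ⟩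
    (y · (y ⇝ x)) ⇝ y  ≈⟨ ⇝-curry y (y ⇝ x) y ⟩
    (y ⇝ x) ⇝ (y ⇝ y)  ≈⟨ ⇝-cong refl (⇝-self y) ⟩
    (y ⇝ x) ⇝ 1#       ≈⟨ Op.≤-maximum (y ⇝ x) ⟩
    1#                 ∎
    where
    x≈y·[y⇝x] : x ≈ y · (y ⇝ x)
    x≈y·[y⇝x] = trans (≤⇒≈∧ x≤y) (trans (⇒⇝-div x y) (⇝-div x y))

  ⇝≈1⇒≤ : ∀ {x y} → x ⇝ y ≈ 1# → x ≤ y
  ⇝≈1⇒≤ {x} {y} x⇝y≈1 = begin
    x ⇒ y              ≈⟨ ⇒-cong x≈[y⇒x]·y refl ⟩
    ((y ⇒ x) · y) ⇒ y  ≈⟨ ⇒-curry (y ⇒ x) y y ⟩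
    (y ⇒ x) ⇒ (y ⇒ y)  ≈⟨ ⇒-cong refl (⇒-self y) ⟩
    (y ⇒ x) ⇒ 1#       ≈⟨ ≤-maximum (y ⇒ x) ⟩
    1#                 ∎
    where
    x≈[y⇒x]·y : x ≈ (y ⇒ x) · y
    x≈[y⇒x]·y = begin
      x            ≈⟨ ·-identityʳ x ⟨
      x · 1#       ≈⟨ ·-cong refl x⇝y≈1 ⟨
      x · (x ⇝ y)  ≈⟨ ⇒⇝-div x y ⟨
      (y ⇒ x) · y  ∎

  y≤x⇒y : ∀ x y → y ≤ x ⇒ y
  y≤x⇒y x y = residualˡ (⇝≈1⇒≤ (begin
    (y · x) ⇝ y  ≈⟨ ⇝-curry y x y ⟩
    x ⇝ (y ⇝ y)  ≈⟨ ⇝-cong refl (⇝-self y) ⟩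
    x ⇝ 1#       ≈⟨ Op.≤-maximum x ⟩
    1#           ∎))

  y≤x⇝y : ∀ x y → y ≤ x ⇝ y
  y≤x⇝y x y = ⇝≈1⇒≤ (begin
    y ⇝ (x ⇝ y)  ≈⟨ ⇝-curry x y y ⟨
    (x · y) ⇝ y  ≈⟨ ≤⇒⇝≈1 x·y≤y ⟩
    1#           ∎)
    where
    x·y≤y : x · y ≤ y
    x·y≤y = unresidualˡ (trans (⇒-cong refl (⇒-self y)) (≤-maximum x))

record IsSubalgebra {c ℓ p} (A : PseudoHoop c ℓ)
                    (P : Pred (PseudoHoop.Carrier A) p) : Set (c ⊔ p) where
  open PseudoHoop A
  field
    1-closed : 1# ∈ P
    ·-closed : ∀ {x y} → x ∈ P → y ∈ P → (x · y) ∈ P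
    ⇒-closed : ∀ {x y} → x ∈ P → y ∈ P → (x ⇒ y) ∈ P
    ⇝-closed : ∀ {x y} → x ∈ P → y ∈ P → (x ⇝ y) ∈ P

-- Equality on the subalgebra ignores the membership proofs.
subalgebra : ∀ {c ℓ p} (A : PseudoHoop c ℓ) {P : Pred (PseudoHoop.Carrier A) p} →
             IsSubalgebra A P → PseudoHoop (c ⊔ p) ℓ
subalgebra A {P} P-sub = record
  { Carrier       = Σ Carrier P
  ; _≈_           = _≈_ on proj₁
  ; _·_           = zip _·_ ·-closed
  ; _⇒_           = zip _⇒_ ⇒-closed
  ; _⇝_           = zip _⇝_ ⇝-closed
  ; 1#            = 1# , 1-closed
  ; isEquivalence = On.isEquivalence proj₁ isEquivalence
  ; ·-cong        = ·-cong
  ; ⇒-cong        = ⇒-cong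
  ; ⇝-cong        = ⇝-cong
  ; ·-identityʳ   = λ (x , _) → ·-identityʳ x
  ; ·-identityˡ   = λ (x , _) → ·-identityˡ x
  ; ⇒-self        = λ (x , _) → ⇒-self x
  ; ⇝-self        = λ (x , _) → ⇝-self x
  ; ⇒-curry       = λ (x , _) (y , _) (z , _) → ⇒-curry x y z
  ; ⇝-curry       = λ (x , _) (y , _) (z , _) → ⇝-curry x y z
  ; ⇒-div         = λ (x , _) (y , _) → ⇒-div x y
  ; ⇒⇝-div        = λ (x , _) (y , _) → ⇒⇝-div x y
  ; ⇝-div         = λ (x , _) (y , _) → ⇝-div x y
  }
  where
  open PseudoHoop A
  open IsSubalgebra P-sub

infixr 2 _×ᴾ_
_×ᴾ_ : ∀ {c₁ ℓ₁ c₂ ℓ₂} → PseudoHoop c₁ ℓ₁ → PseudoHoop c₂ ℓ₂ →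
       PseudoHoop (c₁ ⊔ c₂) (ℓ₁ ⊔ ℓ₂)
A ×ᴾ B = record
  { Carrier       = A.Carrier × B.Carrier
  ; _≈_           = Pointwise A._≈_ B._≈_
  ; _·_           = zip A._·_ B._·_
  ; _⇒_           = zip A._⇒_ B._⇒_
  ; _⇝_           = zip A._⇝_ B._⇝_
  ; 1#            = A.1# , B.1#
  ; isEquivalence = ×-isEquivalence A.isEquivalence B.isEquivalence
  ; ·-cong        = zip A.·-cong B.·-cong
  ; ⇒-cong        = zip A.⇒-cong B.⇒-cong
  ; ⇝-cong        = zip A.⇝-cong B.⇝-cong
  ; ·-identityʳ   = λ (x , y) → A.·-identityʳ x , B.·-identityʳ y
  ; ·-identityˡ   = λ (x , y) → A.·-identityˡ x , B.·-identityˡ y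
  ; ⇒-self        = λ (x , y) → A.⇒-self x , B.⇒-self y
  ; ⇝-self        = λ (x , y) → A.⇝-self x , B.⇝-self y
  ; ⇒-curry       = λ (x , x′) (y , y′) (z , z′) → A.⇒-curry x y z , B.⇒-curry x′ y′ z′
  ; ⇝-curry       = λ (x , x′) (y , y′) (z , z′) → A.⇝-curry x y z , B.⇝-curry x′ y′ z′
  ; ⇒-div         = λ (x , x′) (y , y′) → A.⇒-div x y , B.⇒-div x′ y′
  ; ⇒⇝-div        = λ (x , x′) (y , y′) → A.⇒⇝-div x y , B.⇒⇝-div x′ y′
  ; ⇝-div         = λ (x , x′) (y , y′) → A.⇝-div x y , B.⇝-div x′ y′
  }
  where
  module A = PseudoHoop A
  module B = PseudoHoop B

record IsEmbedding {c₁ ℓ₁ c₂ ℓ₂} (A : PseudoHoop c₁ ℓ₁) (B : PseudoHoop c₂ ℓ₂)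
                   (f : PseudoHoop.Carrier A → PseudoHoop.Carrier B)
                   : Set (c₁ ⊔ ℓ₁ ⊔ ℓ₂) where
  private
    module A = PseudoHoop A
    module B = PseudoHoop B
  field
    cong      : Congruent A._≈_ B._≈_ f
    injective : Injective A._≈_ B._≈_ f
    ·-homo    : ∀ x y → f x B.· f y B.≈ f (x A.· y)
    ⇒-homo    : ∀ x y → f x B.⇒ f y B.≈ f (x A.⇒ y)
    ⇝-homo    : ∀ x y → f x B.⇝ f y B.≈ f (x A.⇝ y)
    1-homo    : f A.1# B.≈ B.1#

module _ {c ℓ p} (A : PseudoHoop c ℓ) (M : Pred (PseudoHoop.Carrier A) p) where
  open PseudoHoop A
  open Properties A

  private
    upward : ∀ {x y m} → x ≤ y → x ∨ m ≈1 → y ∨ m ≈1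
    upward x≤y (_ , m≤1 , least) =
      ≤-maximum _ , m≤1 , λ z y≤z → least z (≤-trans x≤y y≤z)

  ^⊥-isSubalgebra : IsSubalgebra A (M ^⊥)
  ^⊥-isSubalgebra = record
    { 1-closed = λ _ → ≤-refl , ≤-maximum _ , λ _ 1≤z _ → 1≤z
    ; ·-closed = λ {x} {y} x∈ y∈ m∈ →
        ≤-maximum _ , ≤-maximum _ , λ z x·y≤z m≤z →
          proj₂ (proj₂ (y∈ m∈)) z
            (trans (sym (1⇒-identity (y ⇒ z)))
              (proj₂ (proj₂ (x∈ m∈)) (y ⇒ z) (residualˡ x·y≤z)
                (≤-trans m≤z (y≤x⇒y y z))))
            m≤z
    ; ⇒-closed = λ {x} {y} _ y∈ m∈ → upward (y≤x⇒y x y) (y∈ m∈)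
    ; ⇝-closed = λ {x} {y} _ y∈ m∈ → upward (y≤x⇝y x y) (y∈ m∈)
    }

polarProduct : ∀ {c ℓ p} (A : PseudoHoop c ℓ) → Pred (PseudoHoop.Carrier A) p →
               PseudoHoop (c ⊔ ℓ ⊔ p) ℓ
polarProduct A M =
  subalgebra A (^⊥-isSubalgebra A M) ×ᴾ subalgebra A (^⊥-isSubalgebra A (M ^⊥))
  where open PseudoHoop A

polarMeet : ∀ {c ℓ p} (A : PseudoHoop c ℓ) (M : Pred (PseudoHoop.Carrier A) p) →
            let open PseudoHoop A in
            Σ Carrier (M ^⊥) × Σ Carrier (M ^⊥⊥) → Carrier
polarMeet A M ((x , _) , (y , _)) = x ∧ y
  where open PseudoHoop A

{-# OPTIONS --safe #-}
-- If x ∨ y = 1, then x ⇒ y = y and x ⇝ y = y, so x ∧ y = y · x = x · y.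
-- Elements of M^⊥ and M^⊥⊥ have join 1, so they commute and f is
-- multiplicative.  Since residuals distribute over meets, currying reduces
-- (x₁ ∧ y₁) ⇒ (x₂ ∧ y₂) to (x₁ ⇒ x₂) ∧ (y₁ ⇒ y₂); the case of ⇝ is dual.
-- Injectivity follows: f reflects the order, because f(p) ≤ f(q) gives
-- f(p ⇒ q) = 1, and a meet equal to 1 has both of its terms equal to 1.
module Submission where

open import Data.Product.Base using (Σ; _,_; proj₁; proj₂)
open import Defs
open import Relation.Unary using (Pred)
import Relation.Binary.Reasoning.Setoid as SetoidReasoning

module Orthogonality {c ℓ} (A : PseudoHoop c ℓ) where
  open PseudoHoop A
  open Properties A
  open SetoidReasoning setoid

  ∧-cong : ∀ {x y u v} → x ≈ y → u ≈ v → x ∧ u ≈ y ∧ v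
  ∧-cong x≈y u≈v = ·-cong (⇒-cong x≈y u≈v) x≈y

  ⇒-monoʳ : ∀ x {y z} → y ≤ z → x ⇒ y ≤ x ⇒ z
  ⇒-monoʳ x y≤z = residualˡ (≤-trans (unresidualˡ ≤-refl) y≤z)

  -- By residuation, `x ⇒_` is right adjoint to `_· x`, so it preserves meets.
  ⇒-distribˡ-∧ : ∀ x y z → x ⇒ (y ∧ z) ≈ (x ⇒ y) ∧ (x ⇒ z)
  ⇒-distribˡ-∧ x y z = ≤-antisym
    (∧-greatest (⇒-monoʳ x (x∧y≤x y z)) (⇒-monoʳ x (x∧y≤y y z)))
    (residualˡ (∧-greatest (unresidualˡ (x∧y≤x _ _)) (unresidualˡ (x∧y≤y _ _))))

  1≤⇒≈1 : ∀ {x} → 1# ≤ x → x ≈ 1#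
  1≤⇒≈1 1≤x = ≤-antisym (≤-maximum _) 1≤x

  ∧≈1⇒≈1ˡ : ∀ {x y} → x ∧ y ≈ 1# → x ≈ 1#
  ∧≈1⇒≈1ˡ eq = 1≤⇒≈1 (≤-trans (≤-reflexive (sym eq)) (x∧y≤x _ _))

  ∧≈1⇒≈1ʳ : ∀ {x y} → x ∧ y ≈ 1# → y ≈ 1#
  ∧≈1⇒≈1ʳ eq = 1≤⇒≈1 (≤-trans (≤-reflexive (sym eq)) (x∧y≤y _ _))

  ∨≈1-sym : ∀ {x y} → x ∨ y ≈1 → y ∨ x ≈1
  ∨≈1-sym (x≤1 , y≤1 , least) = y≤1 , x≤1 , λ z y≤z x≤z → least z x≤z y≤z

  ∨≈1-monoˡ : ∀ {x y z} → x ≤ y → x ∨ z ≈1 → y ∨ z ≈1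
  ∨≈1-monoˡ x≤y (_ , z≤1 , least) =
    ≤-maximum _ , z≤1 , λ w y≤w → least w (≤-trans x≤y y≤w)

  -- `x ∧ y` is by definition `(x ⇒ y) · x`, so currying `x ∧ y ≤ y` along `⇝` gives this.
  x≤[x⇒y]⇝y : ∀ x y → x ≤ (x ⇒ y) ⇝ y
  x≤[x⇒y]⇝y x y =
    ⇝≈1⇒≤ (trans (sym (⇝-curry (x ⇒ y) x y)) (≤⇒⇝≈1 (x∧y≤y x y)))

  -- (x ⇒ y) ⇝ y is an upper bound of x and y.
  ∨≈1⇒x⇒y≈y : ∀ {x y} → x ∨ y ≈1 → x ⇒ y ≈ y
  ∨≈1⇒x⇒y≈y {x} {y} (_ , _ , least) = ≤-antisym
    (⇝≈1⇒≤ (1≤⇒≈1 (least ((x ⇒ y) ⇝ y) (x≤[x⇒y]⇝y x y) (y≤x⇝y (x ⇒ y) y))))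
    (y≤x⇒y x y)

  ∨≈1⇒∧≈· : ∀ {x y} → x ∨ y ≈1 → x ∧ y ≈ y · x
  ∨≈1⇒∧≈· x∨y = ·-cong (∨≈1⇒x⇒y≈y x∨y) refl

  -- The meet is symmetric, and orthogonality lets it be read as a product in either order.
  ∨≈1⇒·-comm : ∀ {x y} → x ∨ y ≈1 → x · y ≈ y · x
  ∨≈1⇒·-comm {x} {y} x∨y = begin
    x · y  ≈⟨ ∨≈1⇒∧≈· (∨≈1-sym x∨y) ⟨
    y ∧ x  ≈⟨ ⇒-div y x ⟩
    x ∧ y  ≈⟨ ∨≈1⇒∧≈· x∨y ⟩
    y · x  ∎

  -- Once the meets are products, only the inner factors `x₁` and `y₂` have to change places.
  ∧-·-interchange : ∀ {x₁ y₁ x₂ y₂} →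
    x₁ ∨ y₁ ≈1 → x₁ ∨ y₂ ≈1 → x₂ ∨ y₂ ≈1 → (x₁ · x₂) ∨ (y₁ · y₂) ≈1 →
    (x₁ ∧ y₁) · (x₂ ∧ y₂) ≈ (x₁ · x₂) ∧ (y₁ · y₂)
  ∧-·-interchange {x₁} {y₁} {x₂} {y₂} x₁∨y₁ x₁∨y₂ x₂∨y₂ x₁x₂∨y₁y₂ = begin
    (x₁ ∧ y₁) · (x₂ ∧ y₂)  ≈⟨ ·-cong (∨≈1⇒∧≈· x₁∨y₁) (∨≈1⇒∧≈· x₂∨y₂) ⟩
    (y₁ · x₁) · (y₂ · x₂)  ≈⟨ ·-assoc y₁ x₁ (y₂ · x₂) ⟩
    y₁ · (x₁ · (y₂ · x₂))  ≈⟨ ·-cong refl (·-assoc x₁ y₂ x₂) ⟨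
    y₁ · ((x₁ · y₂) · x₂)  ≈⟨ ·-cong refl (·-cong (∨≈1⇒·-comm x₁∨y₂) refl) ⟩
    y₁ · ((y₂ · x₁) · x₂)  ≈⟨ ·-cong refl (·-assoc y₂ x₁ x₂) ⟩
    y₁ · (y₂ · (x₁ · x₂))  ≈⟨ ·-assoc y₁ y₂ (x₁ · x₂) ⟨
    (y₁ · y₂) · (x₁ · x₂)  ≈⟨ ∨≈1⇒∧≈· x₁x₂∨y₁y₂ ⟨
    (x₁ · x₂) ∧ (y₁ · y₂)  ∎

  -- Distributing first `x₁ ⇒_` and then `y₁ ⇒_` leaves two mixed residuals, `x₁ ⇒ y₂` and
  -- `y₁ ⇒ (x₁ ⇒ x₂)`; orthogonality collapses each to its conclusion.
  ∧-⇒-interchange : ∀ {x₁ y₁ x₂ y₂} →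
    x₁ ∨ y₁ ≈1 → x₁ ∨ y₂ ≈1 → x₂ ∨ y₁ ≈1 →
    (x₁ ∧ y₁) ⇒ (x₂ ∧ y₂) ≈ (x₁ ⇒ x₂) ∧ (y₁ ⇒ y₂)
  ∧-⇒-interchange {x₁} {y₁} {x₂} {y₂} x₁∨y₁ x₁∨y₂ x₂∨y₁ = begin
    (x₁ ∧ y₁) ⇒ (x₂ ∧ y₂)             ≈⟨ ⇒-cong (∨≈1⇒∧≈· x₁∨y₁) refl ⟩
    (y₁ · x₁) ⇒ (x₂ ∧ y₂)             ≈⟨ ⇒-curry y₁ x₁ (x₂ ∧ y₂) ⟩
    y₁ ⇒ (x₁ ⇒ (x₂ ∧ y₂))             ≈⟨ ⇒-cong refl (⇒-distribˡ-∧ x₁ x₂ y₂) ⟩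
    y₁ ⇒ ((x₁ ⇒ x₂) ∧ (x₁ ⇒ y₂))      ≈⟨ ⇒-cong refl (∧-cong refl (∨≈1⇒x⇒y≈y x₁∨y₂)) ⟩
    y₁ ⇒ ((x₁ ⇒ x₂) ∧ y₂)             ≈⟨ ⇒-distribˡ-∧ y₁ (x₁ ⇒ x₂) y₂ ⟩
    -- Since `x₂ ≤ x₁ ⇒ x₂`, the element `x₁ ⇒ x₂` inherits orthogonality to `y₁` from `x₂`.
    (y₁ ⇒ (x₁ ⇒ x₂)) ∧ (y₁ ⇒ y₂)      ≈⟨ ∧-cong (∨≈1⇒x⇒y≈y (∨≈1-sym (∨≈1-monoˡ (y≤x⇒y x₁ x₂) x₂∨y₁))) refl ⟩
    (x₁ ⇒ x₂) ∧ (y₁ ⇒ y₂)             ∎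

module DualOrthogonality {c ℓ} (A : PseudoHoop c ℓ) where
  open PseudoHoop A
  open Properties A
  open SetoidReasoning setoid

  private
    module Op = PseudoHoop (opposite A)

  -- The opposite meet unfolds to `x · (x ⇝ y)`, so this is divisibility.
  ∧≈∧ᵒᵖ : ∀ x y → x ∧ y ≈ x Op.∧ y
  ∧≈∧ᵒᵖ x y = trans (⇒-div x y) (⇒⇝-div x y)

  -- The opposite order is defined through `⇝`, yet it is the same relation, so suprema agree.
  ∨≈1⇒∨ᵒᵖ≈1 : ∀ {x y} → x ∨ y ≈1 → x Op.∨ y ≈1
  ∨≈1⇒∨ᵒᵖ≈1 (x≤1 , y≤1 , least) =
    ≤⇒⇝≈1 x≤1 , ≤⇒⇝≈1 y≤1 ,
    λ z x≤z y≤z → ≤⇒⇝≈1 (least z (⇝≈1⇒≤ x≤z) (⇝≈1⇒≤ y≤z))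

  ∧-⇝-interchange : ∀ {x₁ y₁ x₂ y₂} →
    x₁ ∨ y₁ ≈1 → x₁ ∨ y₂ ≈1 → x₂ ∨ y₁ ≈1 →
    (x₁ ∧ y₁) ⇝ (x₂ ∧ y₂) ≈ (x₁ ⇝ x₂) ∧ (y₁ ⇝ y₂)
  ∧-⇝-interchange {x₁} {y₁} {x₂} {y₂} x₁∨y₁ x₁∨y₂ x₂∨y₁ = begin
    (x₁ ∧ y₁) ⇝ (x₂ ∧ y₂)        ≈⟨ ⇝-cong (∧≈∧ᵒᵖ x₁ y₁) (∧≈∧ᵒᵖ x₂ y₂) ⟩
    (x₁ Op.∧ y₁) ⇝ (x₂ Op.∧ y₂)  ≈⟨ Orthogonality.∧-⇒-interchange (opposite A)
                                      (∨≈1⇒∨ᵒᵖ≈1 x₁∨y₁) (∨≈1⇒∨ᵒᵖ≈1 x₁∨y₂) (∨≈1⇒∨ᵒᵖ≈1 x₂∨y₁) ⟩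
    (x₁ ⇝ x₂) Op.∧ (y₁ ⇝ y₂)     ≈⟨ ∧≈∧ᵒᵖ (x₁ ⇝ x₂) (y₁ ⇝ y₂) ⟨
    (x₁ ⇝ x₂) ∧ (y₁ ⇝ y₂)        ∎

module _ {c ℓ p} (A : PseudoHoop c ℓ) (M : Pred (PseudoHoop.Carrier A) p) where
  open PseudoHoop A
  open Orthogonality A

  private
    module P = PseudoHoop (polarProduct A M)
    f : P.Carrier → Carrier
    f = polarMeet A M

  -- Membership in `M ^⊥⊥` is orthogonality to all of `M ^⊥`.
  polar-∨≈1 : (x : Σ Carrier (M ^⊥)) (y : Σ Carrier (M ^⊥⊥)) → proj₁ x ∨ proj₁ y ≈1
  polar-∨≈1 (_ , x∈) (_ , y∈) = ∨≈1-sym (y∈ x∈)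

  polarMeet-⇒-homo : ∀ p q → f p ⇒ f q ≈ f (p P.⇒ q)
  polarMeet-⇒-homo (x₁ , y₁) (x₂ , y₂) =
    ∧-⇒-interchange (polar-∨≈1 x₁ y₁) (polar-∨≈1 x₁ y₂) (polar-∨≈1 x₂ y₁)

  polarMeet-reflects-≤ : ∀ p q → f p ≤ f q → p P.≤ q
  polarMeet-reflects-≤ p q fp≤fq = ∧≈1⇒≈1ˡ f[p⇒q]≈1 , ∧≈1⇒≈1ʳ f[p⇒q]≈1
    where
    f[p⇒q]≈1 : f (p P.⇒ q) ≈ 1#
    f[p⇒q]≈1 = trans (sym (polarMeet-⇒-homo p q)) fp≤fq

theorem4p2 : ∀ {c ℓ p} (A : PseudoHoop c ℓ) (M : Pred (PseudoHoop.Carrier A) p) →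
    IsEmbedding (polarProduct A M) A (polarMeet A M)
theorem4p2 A M = record
  { cong      = λ (x₁≈x₂ , y₁≈y₂) → ∧-cong x₁≈x₂ y₁≈y₂
  ; injective = λ {p} {q} fp≈fq → ResidualProperties.≤-antisym (polarProduct A M) {p} {q}
      (polarMeet-reflects-≤ A M p q (≤-reflexive fp≈fq))
      (polarMeet-reflects-≤ A M q p (≤-reflexive (sym fp≈fq)))
  ; ·-homo    = λ p@(x₁ , y₁) q@(x₂ , y₂) →
      -- Multiplying in the product algebra also yields the proofs that both components stay in
      -- their polars, hence that they are orthogonal.
      let (xy , yy) = p P.· q in
      ∧-·-interchange (⊥ x₁ y₁) (⊥ x₁ y₂) (⊥ x₂ y₂) (⊥ xy yy)
  ; ⇒-homo    = polarMeet-⇒-homo A M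
  ; ⇝-homo    = λ (x₁ , y₁) (x₂ , y₂) →
      ∧-⇝-interchange (⊥ x₁ y₁) (⊥ x₁ y₂) (⊥ x₂ y₁)
  ; 1-homo    = trans (·-identityʳ (1# ⇒ 1#)) (⇒-self 1#)
  }
  where
  open PseudoHoop A
  open Properties A
  open Orthogonality A
  open DualOrthogonality A
  module P = PseudoHoop (polarProduct A M)
  ⊥ = polar-∨≈1 A M
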